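{- Let $G_0$ be any 5-connected plane graph with $n-1$ vertices and with all faces of length three except for a single face bounded by a 4-cycle $x_1x_2x_3x_4$. Let $G$ be the graph obtained from $G_0$ by adding a new vertex $x_5$ adjacent to all vertices of $G_0$. Then $G$ is a 6-connected graph with $n$ vertices and $4n-11$ edges, and the 5-rooted graph with underlying graph $G$ and root set $\{x_1,\ldots,x_5\}$ does not contain $K_5$ as a rooted minor.
   Context: Graphs are finite, simple and undirected. A model of a graph $H$ in a graph $G$ is a function $\mu$ that maps the vertices of $H$ to pairwise disjoint non-empty subsets of $V(G)$ inducing connected subgraphs of $G$, and maps each edge $e=uv$ of $H$ to an edge $\mu(e)$ of $G$ with one end in $\mu(u)$ and the other end in $\mu(v)$. A $k$-rooted graph is a graph $G$ with a specified set $X_G\subseteq V(G)$ of $k$ vertices, called roots. For a bijection $\pi:V(K_k)\to X_G$, a $\pi$-rooted model of $K_k$ in $G$ is a model $\mu$ of $K_k$ in $G$ such that $\pi(v)\in\mu(v)$ for every $v\in V(K_k)$. $K_k$ is a rooted minor of the $k$-rooted graph $G$ if a $\pi$-rooted model of $K_k$ in $G$ exists for some (equivalently, every) bijection $\pi:V(K_k)\to X_G$. -}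

module Defs where

open import Data.Empty using (⊥)
open import Data.Fin.Base using (Fin; zero; suc; toℕ) renaming (_<_ to _<ᶠ_)
open import Data.Fin.Properties using (_≟_; _<?_; suc-injective; 0≢1+n)
open import Data.Fin.Subset using (Subset; inside; outside; _∈_; _∉_; _∪_; ⁅_⁆; ∁; ⊤; ∣_∣; Nonempty)
  renaming (⊥ to ∅)
open import Data.Fin.Subset.Properties
  using (∣⊥∣≡0; ∉⊥; ∪-identityˡ; x∈p∪q⁻; x∈⁅y⁆⇒x≡y)
open import Data.List.Base using (List; length; filter; allFin; cartesianProduct)
open import Data.Nat.Base using (ℕ; zero; suc; _+_; _≤_; _<_; NonZero)
open import Data.Nat.DivMod using (_mod_)
open import Data.Nat.GeneralisedArithmetic using (iterate)
open import Data.Product.Base using (Σ-syntax; ∃-syntax; _×_; _,_; proj₁; proj₂)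
open import Data.Sum.Base using (_⊎_; inj₁; inj₂)
open import Data.Unit.Base using (tt) renaming (⊤ to Unit)
open import Data.Vec.Base using (_∷_; here; there)
open import Function.Base using (_∘_)
open import Function.Bundles using (_⇔_; _⤖_; module Bijection)
open import Function.Definitions using (Injective)
open import Level using (0ℓ)
open import Relation.Binary.Construct.Closure.ReflexiveTransitive using (Star)
open import Relation.Binary.Core using (Rel)
open import Relation.Binary.Definitions using (Decidable; Symmetric; Irreflexive)
open import Relation.Binary.PropositionalEquality
  using (_≡_; _≢_; refl; sym; trans; cong)
open import Relation.Nullary using (¬?; yes; no; contradiction)
open import Relation.Nullary.Decidable using (_×-dec_)

------------------------------------------------------------------------
-- Finite simple graphs

record Graph : Set₁ where
  field
    order    : ℕ
  Vertex : Set
  Vertex = Fin order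
  field
    _~_      : Rel Vertex 0ℓ
    _~?_     : Decidable _~_
    ~-sym    : Symmetric _~_
    ~-irrefl : Irreflexive _≡_ _~_

  vertexPairs : List (Vertex × Vertex)
  vertexPairs = cartesianProduct (allFin order) (allFin order)

  -- An edge is an unordered pair of adjacent vertices, represented by its
  -- increasing ordering, so that every edge has exactly one pair of ends.
  record Edge : Set where
    field
      end₁ end₂ : Vertex
      ordered   : end₁ <ᶠ end₂
      adjacent  : end₁ ~ end₂

  size : ℕ
  size = length (filter (λ (u , v) → (u <? v) ×-dec (u ~? v)) vertexPairs)

  InducedAdj : Subset order → Rel Vertex 0ℓ
  InducedAdj S u v = u ∈ S × v ∈ S × u ~ v

  -- The subgraph induced by S is connected.
  InducesConnected : Subset order → Set
  InducesConnected S = ∀ {u v} → u ∈ S → v ∈ S → Star (InducedAdj S) u v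

  Connected : Set
  Connected = InducesConnected ⊤

  KConnected : ℕ → Set
  KConnected k = k < order × (∀ S → ∣ S ∣ < k → InducesConnected (∁ S))

open Graph public using (order; Vertex; size; Edge; InducesConnected; Connected; KConnected)

complete : ℕ → Graph
complete k = record
  { order    = k
  ; _~_      = _≢_
  ; _~?_     = λ u v → ¬? (u ≟ v)
  ; ~-sym    = λ u≢v v≡u → u≢v (sym v≡u)
  ; ~-irrefl = λ u≡v u≢v → u≢v u≡v
  }

------------------------------------------------------------------------
-- Adding a vertex adjacent to all others

module _ (G : Graph) where
  open Graph G hiding (order; Vertex)

  ConeAdj : Rel (Fin (suc (order G))) 0ℓ
  ConeAdj zero    zero    = ⊥
  ConeAdj zero    (suc v) = Unit
  ConeAdj (suc u) zero    = Unit
  ConeAdj (suc u) (suc v) = u ~ v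

  coneAdj? : Decidable ConeAdj
  coneAdj? zero    zero    = no λ ()
  coneAdj? zero    (suc v) = yes tt
  coneAdj? (suc u) zero    = yes tt
  coneAdj? (suc u) (suc v) = u ~? v

  coneAdj-sym : Symmetric ConeAdj
  coneAdj-sym {zero}  {suc v} _ = tt
  coneAdj-sym {suc u} {zero}  _ = tt
  coneAdj-sym {suc u} {suc v} p = ~-sym p

  coneAdj-irrefl : Irreflexive _≡_ ConeAdj
  coneAdj-irrefl {suc u} refl p = ~-irrefl refl p

  cone : Graph
  cone = record
    { order    = suc (order G)
    ; _~_      = ConeAdj
    ; _~?_     = coneAdj?
    ; ~-sym    = λ {u} {v} → coneAdj-sym {u} {v}
    ; ~-irrefl = λ {u} {v} → coneAdj-irrefl {u} {v}
    }

  apex : Vertex cone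
  apex = zero

  base : Vertex G → Vertex cone
  base = suc

------------------------------------------------------------------------
-- Cycles

next : ∀ {k} .{{_ : NonZero k}} → Fin k → Fin k
next {k} i = suc (toℕ i) mod k

record IsCycle (G : Graph) {k : ℕ} .{{_ : NonZero k}} (x : Fin k → Vertex G) : Set where
  open Graph G using (_~_)
  field
    3≤k       : 3 ≤ k
    injective : Injective _≡_ _≡_ x
    adjacent  : ∀ i → x i ~ x (next i)

CycleEdge : ∀ {V : Set} {k} .{{_ : NonZero k}} → (Fin k → V) → V → V → Set
CycleEdge x u v = ∃[ i ] ((u ≡ x i × v ≡ x (next i)) ⊎ (v ≡ x i × u ≡ x (next i)))

------------------------------------------------------------------------
-- Plane graphs

-- A connected plane graph, given combinatorially by its rotation system: the
-- cyclic order of the neighbours around each vertex.  An ordered pair (u , v)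
-- of adjacent vertices is a dart, i.e. a side of the edge uv.  The faces are
-- the orbits of the darts under face tracing, which enters v from u and leaves
-- along the edge following uv in the rotation at v.  The rotation system
-- describes an embedding in the sphere exactly when Euler's formula holds.
-- (A graph without edges has no darts, hence no face in this sense; so the
-- one-vertex graph is not covered.)
--
-- The values of rot v outside the neighbourhood of v, and of face outside the
-- darts, carry no information.
record PlaneEmbedding (G : Graph) : Set where
  open Graph G hiding (order; Vertex; size; Connected)
  field
    connected : Connected G

    rot        : Vertex G → Vertex G → Vertex G
    rot-closed : ∀ {v w} → v ~ w → v ~ rot v w
    -- A single orbit; as there are finitely many neighbours, this makes rot v
    -- a cyclic permutation of them.
    rot-cyclic : ∀ {v w w′} → v ~ w → v ~ w′ → ∃[ k ] iterate (rot v) w k ≡ w′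

  trace : Vertex G × Vertex G → Vertex G × Vertex G
  trace (u , v) = v , rot v u

  IsDart : Vertex G × Vertex G → Set
  IsDart (u , v) = u ~ v

  field
    #faces    : ℕ
    face      : Vertex G × Vertex G → Fin #faces
    face-onto : ∀ f → ∃[ d ] (IsDart d × face d ≡ f)
    face-orbit : ∀ {d d′} → IsDart d → IsDart d′ →
                 face d ≡ face d′ ⇔ (∃[ k ] iterate trace d k ≡ d′)

    euler : order G + #faces ≡ size G + 2

  Face : Set
  Face = Fin #faces

  -- The length of the boundary walk of f; an edge with f on both sides is
  -- counted twice.
  faceLength : Face → ℕ
  faceLength f =
    length (filter (λ (u , v) → (u ~? v) ×-dec (face (u , v) ≟ f)) vertexPairs)

  OnBoundary : Face → Vertex G → Vertex G → Set
  OnBoundary f u v = face (u , v) ≡ f ⊎ face (v , u) ≡ f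

  BoundedByCycle : Face → ∀ {k} .{{_ : NonZero k}} → (Fin k → Vertex G) → Set
  BoundedByCycle f x =
    IsCycle G x × (∀ {u v} → u ~ v → OnBoundary f u v ⇔ CycleEdge x u v)

------------------------------------------------------------------------
-- Models and rooted minors

record Model (H G : Graph) : Set where
  field
    branch           : Vertex H → Subset (order G)
    branch-nonempty  : ∀ v → Nonempty (branch v)
    branch-connected : ∀ v → InducesConnected G (branch v)
    branch-disjoint  : ∀ {u v} → u ≢ v → ∀ {w} → w ∈ branch u → w ∉ branch v
    edge             : Edge H → Edge G
    edge-ends        : ∀ e → let open Edge in
      (end₁ (edge e) ∈ branch (end₁ e) × end₂ (edge e) ∈ branch (end₂ e)) ⊎
      (end₁ (edge e) ∈ branch (end₂ e) × end₂ (edge e) ∈ branch (end₁ e))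

record RootedGraph (k : ℕ) : Set₁ where
  field
    graph   : Graph
    roots   : Subset (order graph)
    ∣roots∣ : ∣ roots ∣ ≡ k

  Root : Set
  Root = ∃[ v ] v ∈ roots

  IsRooted : (Vertex (complete k) ⤖ Root) → Model (complete k) graph → Set
  IsRooted π μ = ∀ v → proj₁ (Bijection.to π v) ∈ Model.branch μ v

HasRootedCompleteMinor : ∀ {k} → RootedGraph k → Set
HasRootedCompleteMinor {k} R =
  Σ[ π ∈ (Vertex (complete k) ⤖ Root) ]
  Σ[ μ ∈ Model (complete k) graph ] IsRooted π μ
  where open RootedGraph R

image : ∀ {n k} → (Fin k → Fin n) → Subset n
image {k = zero}  x = ∅
image {k = suc k} x = ⁅ x zero ⁆ ∪ image (x ∘ suc)

∈-image⁻ : ∀ {n k} (x : Fin k → Fin n) {v} → v ∈ image x → ∃[ i ] v ≡ x i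
∈-image⁻ {k = zero}  x p = contradiction p ∉⊥
∈-image⁻ {k = suc k} x p with x∈p∪q⁻ ⁅ x zero ⁆ _ p
... | inj₁ q = zero , x∈⁅y⁆⇒x≡y _ q
... | inj₂ q = let i , eq = ∈-image⁻ (x ∘ suc) q in suc i , eq

∣⁅x⁆∪p∣ : ∀ {n} (v : Fin n) (p : Subset n) → v ∉ p → ∣ ⁅ v ⁆ ∪ p ∣ ≡ suc ∣ p ∣
∣⁅x⁆∪p∣ zero    (inside  ∷ p) v∉p = contradiction here v∉p
∣⁅x⁆∪p∣ zero    (outside ∷ p) v∉p = cong (suc ∘ ∣_∣) (∪-identityˡ p)
∣⁅x⁆∪p∣ (suc v) (inside  ∷ p) v∉p = cong suc (∣⁅x⁆∪p∣ v p (v∉p ∘ there))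
∣⁅x⁆∪p∣ (suc v) (outside ∷ p) v∉p = ∣⁅x⁆∪p∣ v p (v∉p ∘ there)

∣image∣ : ∀ {n k} (x : Fin k → Fin n) → Injective _≡_ _≡_ x → ∣ image x ∣ ≡ k
∣image∣ {n} {zero} x inj = ∣⊥∣≡0 n
∣image∣ {k = suc k} x inj =
  trans (∣⁅x⁆∪p∣ (x zero) (image (x ∘ suc)) x₀∉)
        (cong suc (∣image∣ (x ∘ suc) (suc-injective ∘ inj)))
  where
  x₀∉ : x zero ∉ image (x ∘ suc)
  x₀∉ p = let i , eq = ∈-image⁻ (x ∘ suc) p in 0≢1+n (inj eq)

rootedAt : ∀ {k} (G : Graph) (x : Fin k → Vertex G) → Injective _≡_ _≡_ x → RootedGraph k
rootedAt G x inj = record { graph = G ; roots = image x ; ∣roots∣ = ∣image∣ x inj }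

module _ (G : Graph) {k : ℕ} (x : Fin k → Vertex G) where

  -- The given vertices x of G together with the apex of the cone.
  withApex : Fin (suc k) → Vertex (cone G)
  withApex zero    = apex G
  withApex (suc i) = base G (x i)

  withApex-injective : Injective _≡_ _≡_ x → Injective _≡_ _≡_ withApex
  withApex-injective inj {zero}  {zero}  _  = refl
  withApex-injective inj {suc i} {suc j} eq = cong suc (inj (suc-injective eq))

  rootedCone : Injective _≡_ _≡_ x → RootedGraph (suc k)
  rootedCone inj = rootedAt (cone G) withApex (withApex-injective inj)

{-# OPTIONS --safe #-}
module Submission where

-- The connectivity of the cone is immediate, and its size follows from Euler's
-- formula by counting darts along faces.  For the minor, discard the branch set of
-- the apex: the branch sets of x₁, x₃ and of x₂, x₄ join up to disjoint connected
-- sets A and B of G₀ containing opposite corners of the face f₀, which planarity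
-- forbids.  The only consequence of planarity used is that the first homology is
-- torsion, which is Euler's formula turned into a count of equations and unknowns:
-- a closed walk through A and two sides of f₀ bounds a chain of faces up to a
-- nonzero factor, and along B the coefficients of this chain cannot change.

open import Defs
import Algebra.Properties.Semiring.Sum as SemiringSum
open import Data.Bool.Base using (if_then_else_)
open import Data.Empty using (⊥)
open import Data.Fin.Base as Fin
  using (Fin; zero; suc; punchIn; punchOut; opposite; _↑ˡ_; _↑ʳ_; splitAt; join)
open import Data.Fin.Patterns using (0F; 1F; 2F; 3F; 4F)
open import Data.Fin.Permutation using (Permutation′; permutation; _⟨$⟩ʳ_)
open import Data.Fin.Properties
  using (_≟_; _<?_; <-cmp; any?; suc-injective; injective⇒≤; join-splitAt; opposite-involutive;
         punchInᵢ≢i; punchOut-injective; punchOut-punchIn)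
open import Data.Fin.Subset using (inside; outside; _∈_; _∉_; ∁; ∣_∣)
open import Data.Fin.Subset.Properties using (∈⊤; x∈p∪q⁺; x∈⁅x⁆)
open import Data.List.Base
  using ([]; _∷_; _++_; length; lookup; map; filter; tabulate; allFin; cartesianProduct)
import Data.List.Membership.Propositional as List
open import Data.List.Membership.Propositional.Properties using (∈-filter⁺; ∈-allFin; ∈-cartesianProduct⁺)
open import Data.List.Properties using (filter-++; length-++; map-tabulate)
open import Data.List.Relation.Unary.Any using (index)
open import Data.List.Relation.Unary.Any.Properties using (lookup-index)
open import Data.Nat.Base as ℕ using (ℕ; zero; suc; s≤s; z<s; s<s)
open import Data.Nat.GeneralisedArithmetic using (iterate)
import Data.Nat.Properties as ℕ
import Data.Nat.Tactic.RingSolver as ℕ-Solver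
open import Data.Product.Base using (∃-syntax; ∃₂; _×_; _,_; proj₁; proj₂)
open import Data.Sum.Base using (_⊎_; inj₁; inj₂; [_,_]′)
open import Data.Unit.Base using (tt)
open import Data.Vec.Base as Vec using (here; there)
open import Function.Base using (_∘_)
open import Function.Bundles using (Bijection; Equivalence)
open import Function.Definitions using (Injective)
open import Level using (0ℓ)
open import Relation.Binary.Construct.Closure.ReflexiveTransitive as Star using (Star; ε; _◅_; _◅◅_)
open import Relation.Binary.Definitions using (tri<; tri≈; tri>)
open import Relation.Binary.PropositionalEquality
  using (_≡_; _≢_; refl; sym; trans; cong; cong₂; subst; module ≡-Reasoning)
open import Relation.Nullary using (¬_; Dec; does; yes; no; contradiction)
open import Relation.Nullary.Decidable using (¬?; _×-dec_; decidable-stable; dec-true; dec-false)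
open import Relation.Unary using (Pred; Decidable)

-- Planarity enters as a bare numerical identity, so separation has to come from linear algebra, and
-- an underdetermined system gives some solution without saying which. The danger is a solution that
-- ignores the closed walk, its coefficient on the walk being zero. It is excluded by two
-- normalisations together with a sum of squares. The squares need an ordered ring, so coefficients
-- mod 2 would not do. Integers suffice, because a nonzero factor on the walk is harmless: it only
-- rescales the jump of the face coefficients across the walk. The boundary of `f₀` is given as a
-- set of undirected edges, whereas the jump argument needs the direction in which the face is
-- traced; that direction has to be recovered first. The constant 11: if one face has length 4 and
-- the others have length 3, then 2E = 3F + 1, and Euler's formula gives E = 3V - 7. The cone adds V
-- edges, and V = n - 1.

module _ where
  open import Data.Integer.Base using (ℤ; 0ℤ; 1ℤ; _+_; _-_; _*_; -_; _≤_; +_; -[1+_]; +≤+)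
  import Data.Integer.Properties as ℤ
  open import Data.Integer.Tactic.RingSolver using (solve)
  private module Sum = SemiringSum ℤ.+-*-semiring
  open ≡-Reasoning

  -- Indicators and finite sums

  𝟙 : ∀ {P : Set} → Dec P → ℤ
  𝟙 P? = if does P? then 1ℤ else 0ℤ

  𝟙-true : ∀ {P : Set} (P? : Dec P) → P → 𝟙 P? ≡ 1ℤ
  𝟙-true P? p = cong (if_then 1ℤ else 0ℤ) (dec-true P? p)

  𝟙-false : ∀ {P : Set} (P? : Dec P) → ¬ P → 𝟙 P? ≡ 0ℤ
  𝟙-false P? ¬p = cong (if_then 1ℤ else 0ℤ) (dec-false P? ¬p)

  𝟙-cong : ∀ {P Q : Set} (P? : Dec P) (Q? : Dec Q) → (P → Q) → (Q → P) → 𝟙 P? ≡ 𝟙 Q?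
  𝟙-cong P? Q? to from with P?
  ... | yes p = sym (𝟙-true Q? (to p))
  ... | no ¬p = sym (𝟙-false Q? (¬p ∘ from))

  δ : ∀ {n} → Fin n → Fin n → ℤ
  δ i j = 𝟙 (i ≟ j)

  -- Opaque, so that Agda can unify the summands of two sums.
  opaque
    sum : ∀ {n} → (Fin n → ℤ) → ℤ
    sum = Sum.sum

  opaque
    unfolding sum

    sum-[] : ∀ (f : Fin 0 → ℤ) → sum f ≡ 0ℤ
    sum-[] f = refl

    sum-∷ : ∀ {n} (f : Fin (suc n) → ℤ) → sum f ≡ f zero + sum (f ∘ suc)
    sum-∷ f = refl

    sum-cong : ∀ {n} {f g : Fin n → ℤ} → (∀ i → f i ≡ g i) → sum f ≡ sum g
    sum-cong = Sum.sum-cong-≗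

    sum-zero : ∀ {n} {f : Fin n → ℤ} → (∀ i → f i ≡ 0ℤ) → sum f ≡ 0ℤ
    sum-zero {n} f≡0 = trans (sum-cong f≡0) (Sum.sum-replicate-zero n)

    sum-remove : ∀ {n} i (f : Fin (suc n) → ℤ) → sum f ≡ f i + sum (f ∘ punchIn i)
    sum-remove i f = Sum.sum-remove {i = i} f

    sum-+ : ∀ {n} (f g : Fin n → ℤ) → sum (λ i → f i + g i) ≡ sum f + sum g
    sum-+ = Sum.∑-distrib-+

    sum-comm : ∀ {m n} (f : Fin m → Fin n → ℤ) →
               sum (λ i → sum (f i)) ≡ sum (λ j → sum (λ i → f i j))
    sum-comm = Sum.∑-comm

    sum-permute : ∀ {n} (f : Fin n → ℤ) (π : Permutation′ n) → sum f ≡ sum (λ i → f (π ⟨$⟩ʳ i))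
    sum-permute = Sum.sum-permute

    *-sum : ∀ {n} a (f : Fin n → ℤ) → a * sum f ≡ sum (λ i → a * f i)
    *-sum = Sum.*-distribˡ-sum

    sum-* : ∀ {n} a (f : Fin n → ℤ) → sum f * a ≡ sum (λ i → f i * a)
    sum-* = Sum.*-distribʳ-sum

  sum-δ : ∀ {n} (i : Fin n) (f : Fin n → ℤ) → sum (λ j → δ i j * f j) ≡ f i
  sum-δ {suc n} i f = begin
    sum (λ j → δ i j * f j)
      ≡⟨ sum-remove i (λ j → δ i j * f j) ⟩
    δ i i * f i + sum (λ j → δ i (punchIn i j) * f (punchIn i j))
      ≡⟨ cong₂ _+_ (cong (_* f i) (𝟙-true (i ≟ i) refl)) (sum-zero λ j →
           cong (_* f (punchIn i j)) (𝟙-false (i ≟ punchIn i j) (punchInᵢ≢i i j ∘ sym))) ⟩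
    1ℤ * f i + 0ℤ
      ≡⟨ trans (ℤ.+-identityʳ _) (ℤ.*-identityˡ (f i)) ⟩
    f i ∎

  sum-sub : ∀ {n} (f g : Fin n → ℤ) → sum (λ i → f i - g i) ≡ sum f - sum g
  sum-sub f g = begin
    sum (λ i → f i - g i)       ≡⟨ sum-+ f (-_ ∘ g) ⟩
    sum f + sum (-_ ∘ g)        ≡⟨ cong (_+_ (sum f)) (sum-cong (λ i → sym (ℤ.-1*i≡-i (g i)))) ⟩
    sum f + sum (λ i → - 1ℤ * g i) ≡⟨ cong (_+_ (sum f)) (sym (*-sum (- 1ℤ) g)) ⟩
    sum f + - 1ℤ * sum g        ≡⟨ cong (_+_ (sum f)) (ℤ.-1*i≡-i (sum g)) ⟩
    sum f - sum g               ∎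

  sum-nonneg : ∀ {n} {f : Fin n → ℤ} → (∀ i → 0ℤ ≤ f i) → 0ℤ ≤ sum f
  sum-nonneg {zero}  {f} 0≤f = ℤ.≤-reflexive (sym (sum-[] f))
  sum-nonneg {suc n} {f} 0≤f = subst (0ℤ ≤_) (sym (sum-∷ f)) (ℤ.+-mono-≤ (0≤f zero) (sum-nonneg (0≤f ∘ suc)))

  i+j≡0⇒i≡0 : ∀ {i j} → 0ℤ ≤ i → 0ℤ ≤ j → i + j ≡ 0ℤ → i ≡ 0ℤ
  i+j≡0⇒i≡0 {i} {j} 0≤i 0≤j eq = ℤ.≤-antisym
    (subst (_≤ 0ℤ) (ℤ.+-identityʳ i) (subst (i + 0ℤ ≤_) eq (ℤ.+-monoʳ-≤ i 0≤j))) 0≤i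

  sum≡0⇒all≡0 : ∀ {n} {f : Fin n → ℤ} → (∀ i → 0ℤ ≤ f i) → sum f ≡ 0ℤ → ∀ i → f i ≡ 0ℤ
  sum≡0⇒all≡0 {suc n} {f} 0≤f eq i = i+j≡0⇒i≡0 (0≤f i) (sum-nonneg (0≤f ∘ punchIn i))
    (trans (sym (sum-remove i f)) eq)

  i*i≡0⇒i≡0 : ∀ i → i * i ≡ 0ℤ → i ≡ 0ℤ
  i*i≡0⇒i≡0 i eq = [ (λ p → p) , (λ p → p) ]′ (ℤ.i*j≡0⇒i≡0∨j≡0 i eq)

  0≤i*i : ∀ i → 0ℤ ≤ i * i
  0≤i*i (+ n)          = subst (0ℤ ≤_) (ℤ.pos-* n n) (+≤+ ℕ.z≤n)
  0≤i*i (-[1+ n ])   = +≤+ ℕ.z≤n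

  -- Homogeneous linear systems

  _·_ : ∀ {n} → (Fin n → ℤ) → (Fin n → ℤ) → ℤ
  r · x = sum (λ j → r j * x j)

  -- Fraction-free Gaussian elimination.
  underdetermined : ∀ {m n} (M : Fin m → Fin n → ℤ) → m ℕ.< n →
                    ∃[ x ] (∃[ j ] x j ≢ 0ℤ) × (∀ i → M i · x ≡ 0ℤ)
  underdetermined {zero}  {suc n} M _ = (λ _ → 1ℤ) , (zero , λ ()) , λ ()
  underdetermined {suc m} {suc n} M (s≤s m<n) with any? (λ j → ¬? (M zero j ℤ.≟ 0ℤ))
  ... | no ¬pivot =
    let x , x≢0 , Mx≡0 = underdetermined (M ∘ suc) (ℕ.<-trans m<n (ℕ.n<1+n n))
    in x , x≢0 , λ where
      zero    → sum-zero λ j → cong (_* x j)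
                  (decidable-stable (M zero j ℤ.≟ 0ℤ) (λ r≢0 → ¬pivot (j , r≢0)))
      (suc i) → Mx≡0 i
  ... | yes (p , a≢0) = x , (punchIn p (proj₁ y≢0) , x≢0) , Mx≡0
    where
    a = M zero p
    M′ : Fin m → Fin n → ℤ
    -- The entries are the 2 × 2 minors containing the pivot, so the pivot column is cleared without
    -- division.
    M′ i k = a * M (suc i) (punchIn p k) - M (suc i) p * M zero (punchIn p k)
    sol = underdetermined M′ m<n
    y = proj₁ sol
    y≢0 = proj₁ (proj₂ sol)
    s = sum (λ k → M zero (punchIn p k) * y k)
    -- Back substitution multiplied through by `a`: row zero becomes a(-s) + as = 0, and since `a`
    -- is nonzero a nonzero entry of `y` stays nonzero.
    x : Fin (suc n) → ℤ
    x j with p ≟ j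
    ... | yes _  = - s
    ... | no p≢j = a * y (punchOut p≢j)
    x-pivot : x p ≡ - s
    x-pivot with p ≟ p
    ... | yes _  = refl
    ... | no p≢p = contradiction refl p≢p
    x-rest : ∀ k → x (punchIn p k) ≡ a * y k
    x-rest k with p ≟ punchIn p k
    ... | yes eq = contradiction (sym eq) (punchInᵢ≢i p k)
    ... | no p≢  = cong (λ z → a * y z) (punchOut-punchIn p)
    x≢0 : x (punchIn p (proj₁ y≢0)) ≢ 0ℤ
    x≢0 eq = [ a≢0 , proj₂ y≢0 ]′ (ℤ.i*j≡0⇒i≡0∨j≡0 a (trans (sym (x-rest _)) eq))
    expand : ∀ (r : Fin (suc n) → ℤ) → r · x ≡ r p * - s + a * sum (λ k → r (punchIn p k) * y k)
    expand r = trans (sum-remove p (λ j → r j * x j)) (cong₂ _+_ (cong (r p *_) x-pivot)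
      (trans (sum-cong λ k → trans (cong (r (punchIn p k) *_) (x-rest k))
                                     (comm a (r (punchIn p k)) (y k)))
             (sym (*-sum a _))))
      where
      comm : ∀ a b c → b * (a * c) ≡ a * (b * c)
      comm a b c = solve (a ∷ b ∷ c ∷ [])
    Mx≡0 : ∀ i → M i · x ≡ 0ℤ
    Mx≡0 zero    = trans (expand (M zero)) (cancel a s)
      where
      cancel : ∀ a s → a * - s + a * s ≡ 0ℤ
      cancel a s = solve (a ∷ s ∷ [])
    Mx≡0 (suc i) = begin
      M (suc i) · x
        ≡⟨ expand (M (suc i)) ⟩
      b * - s + a * t
        ≡⟨ regroup a b s t ⟩
      a * t - b * s
        ≡⟨ cong₂ _-_ (*-sum a _) (*-sum b _) ⟩
      sum (λ k → a * (M (suc i) (punchIn p k) * y k)) - sum (λ k → b * (M zero (punchIn p k) * y k))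
        ≡⟨ sym (sum-sub _ _) ⟩
      sum (λ k → a * (M (suc i) (punchIn p k) * y k) - b * (M zero (punchIn p k) * y k))
        ≡⟨ sum-cong (λ k → factor a b (M (suc i) (punchIn p k)) (M zero (punchIn p k)) (y k)) ⟩
      M′ i · y
        ≡⟨ proj₂ (proj₂ sol) i ⟩
      0ℤ ∎
      where
      b = M (suc i) p
      t = sum (λ k → M (suc i) (punchIn p k) * y k)
      regroup : ∀ a b s t → b * - s + a * t ≡ a * t - b * s
      regroup a b s t = solve (a ∷ b ∷ s ∷ t ∷ [])
      factor : ∀ a b c d e → a * (c * e) - b * (d * e) ≡ (a * c - b * d) * e
      factor a b c d e = solve (a ∷ b ∷ c ∷ d ∷ e ∷ [])

  -- The coefficient row is part of the witness. Equations can thus be written as ordinary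
  -- expressions in the unknowns, and the closure lemmas below assemble their matrix.
  IsLinear : ∀ {n} → ((Fin n → ℤ) → ℤ) → Set
  IsLinear L = ∃[ r ] ∀ x → L x ≡ r · x

  coordinate-linear : ∀ {n} (j : Fin n) → IsLinear (λ x → x j)
  coordinate-linear j = δ j , λ x → sym (sum-δ j x)

  minus-linear : ∀ {n} {L L′ : (Fin n → ℤ) → ℤ} → IsLinear L → IsLinear L′ → IsLinear (λ x → L x - L′ x)
  minus-linear (r , L≡r) (r′ , L′≡r′) = (λ j → r j - r′ j) , λ x →
    trans (cong₂ _-_ (L≡r x) (L′≡r′ x)) (trans (sym (sum-sub _ _))
      (sum-cong λ j → factor (r j) (r′ j) (x j)))
    where
    factor : ∀ a b c → a * c - b * c ≡ (a - b) * c
    factor a b c = solve (a ∷ b ∷ c ∷ [])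

  scale-linear : ∀ {n} {L : (Fin n → ℤ) → ℤ} → IsLinear L → ∀ a → IsLinear (λ x → L x * a)
  scale-linear (r , L≡r) a = (λ j → r j * a) , λ x →
    trans (cong (_* a) (L≡r x)) (trans (sum-* a _) (sum-cong λ j → swap (r j) (x j)))
    where
    swap : ∀ b c → b * c * a ≡ b * a * c
    swap b c = solve (a ∷ b ∷ c ∷ [])

  nontrivialZero : ∀ {m n} (L : Fin m → (Fin n → ℤ) → ℤ) → (∀ i → IsLinear (L i)) → m ℕ.< n →
                   ∃[ x ] (∃[ j ] x j ≢ 0ℤ) × (∀ i → L i x ≡ 0ℤ)
  nontrivialZero L lin m<n =
    let x , x≢0 , Mx≡0 = underdetermined (proj₁ ∘ lin) m<n
    in x , x≢0 , λ i → trans (proj₂ (lin i) x) (Mx≡0 i)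

  -- A missed value could be punched out of the codomain, leaving an injection into a smaller finite
  -- set.
  injective⇒surjective : ∀ {n} {f : Fin n → Fin n} → Injective _≡_ _≡_ f → ∀ i → ∃[ j ] f j ≡ i
  injective⇒surjective {suc n} {f} inj i with any? (λ j → f j ≟ i)
  ... | yes p = p
  ... | no ¬p = contradiction (injective⇒≤ {f = λ j → punchOut (i≢f j)}
                  (λ {j} {k} eq → inj (punchOut-injective (i≢f j) (i≢f k) eq))) ℕ.1+n≰n
    where
    i≢f : ∀ j → i ≢ f j
    i≢f j eq = ¬p (j , sym eq)

  -- Rotation systems, circulations and homology

  module Embedding {G : Graph} (P : PlaneEmbedding G) where
    open Graph G using (_~_; _~?_; ~-sym; ~-irrefl; vertexPairs)
    open PlaneEmbedding P

    private
      V = order G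

    -- The orbit of one neighbour under `rot v` contains every other one and never leaves the
    -- neighbourhood, so an invariant of a single turn spreads to all neighbours.
    rotation-induction : ∀ {v} (Q : Vertex G → Set) → (∀ {w} → v ~ w → Q w → Q (rot v w)) →
                         ∀ {w w′} → v ~ w → v ~ w′ → Q w → Q w′
    rotation-induction {v} Q step v~w v~w′ q =
      let k , eq = rot-cyclic v~w v~w′ in subst Q eq (iterated k v~w q)
      where
      iterated : ∀ k {w} → v ~ w → Q w → Q (iterate (rot v) w k)
      iterated zero    v~w q = q
      iterated (suc k) v~w q = iterated k (rot-closed v~w) (step v~w q)

    face-rot : ∀ {v w} → v ~ w → face (v , rot v w) ≡ face (w , v)
    face-rot v~w = sym (Equivalence.from (face-orbit (~-sym v~w) (rot-closed v~w)) (1 , refl))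

    α : Vertex G → Vertex G → ℤ
    α u v = 𝟙 (u ~? v)

    private
      -- Off the neighbourhood `rot v` is arbitrary; replacing it there by the identity gives a
      -- permutation of all vertices, by which sums can be reindexed.
      rot⁺ : Vertex G → Vertex G → Vertex G
      rot⁺ v w = if does (v ~? w) then rot v w else w

      rot⁺-adjacent : ∀ {v w} → v ~ w → rot⁺ v w ≡ rot v w
      rot⁺-adjacent {v} {w} v~w with v ~? w
      ... | yes _  = refl
      ... | no v≁w = contradiction v~w v≁w

      rot⁺-preimage : ∀ v w → ∃[ y ] rot⁺ v y ≡ w
      rot⁺-preimage v w with v ~? w in eq
      ... | yes v~w =
        -- The orbit starts at `rot v w` instead of `w`, so that even zero iterations leave a last
        -- turn and hence a preimage.
        let k , eq = rot-cyclic (rot-closed v~w) v~w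
            y , v~y , eq′ = predecessor k v~w
        in y , trans (rot⁺-adjacent v~y) (trans eq′ eq)
        where
        predecessor : ∀ k {w} → v ~ w → ∃[ y ] v ~ y × rot v y ≡ iterate (rot v) (rot v w) k
        predecessor zero    {w} v~w = w , v~w , refl
        predecessor (suc k) v~w = predecessor k (rot-closed v~w)
      ... | no v≁w = w , fixed
        where
        fixed : rot⁺ v w ≡ w
        fixed rewrite eq = refl

      -- A section of a self-map of a finite set is injective, hence onto, hence a two-sided
      -- inverse.
      rot⁺-permutation : Vertex G → Permutation′ V
      rot⁺-permutation v = permutation (rot⁺ v) pre (proj₂ ∘ rot⁺-preimage v) pre-rot⁺
        where
        pre = proj₁ ∘ rot⁺-preimage v
        pre-injective : ∀ {a b} → pre a ≡ pre b → a ≡ b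
        pre-injective {a} {b} eq = trans (sym (proj₂ (rot⁺-preimage v a)))
          (trans (cong (rot⁺ v) eq) (proj₂ (rot⁺-preimage v b)))
        pre-rot⁺ : ∀ w → pre (rot⁺ v w) ≡ w
        pre-rot⁺ w with y , refl ← injective⇒surjective pre-injective w =
          cong pre (proj₂ (rot⁺-preimage v y))

    -- An integral 1-cycle. It is stored on all ordered pairs of vertices, with value zero off the
    -- edges, so that every sum can run over all vertices.
    record Circulation (z : Vertex G → Vertex G → ℤ) : Set where
      field
        antisymmetric : ∀ u v → z u v ≡ - z v u
        supported     : ∀ {u v} → ¬ u ~ v → z u v ≡ 0ℤ
        conserved     : ∀ u → sum (z u) ≡ 0ℤ

      conservedʳ : ∀ v → sum (λ u → z u v) ≡ 0ℤ
      conservedʳ v = begin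
        sum (λ u → z u v)         ≡⟨ sum-cong (λ u → trans (antisymmetric u v) (sym (ℤ.-1*i≡-i (z v u)))) ⟩
        sum (λ u → - 1ℤ * z v u)  ≡⟨ sym (*-sum (- 1ℤ) (z v)) ⟩
        - 1ℤ * sum (z v)          ≡⟨ cong (- 1ℤ *_) (conserved v) ⟩
        0ℤ                        ∎

    open Circulation

    -- The cellular boundary of the 2-chain `h`; the factor `α` silences `face` off the darts, where
    -- it means nothing.
    ∂ : (Face → ℤ) → Vertex G → Vertex G → ℤ
    ∂ h u v = α u v * (h (face (u , v)) - h (face (v , u)))

    α-sym : ∀ u v → α u v ≡ α v u
    α-sym u v = 𝟙-cong (u ~? v) (v ~? u) ~-sym ~-sym

    -- The boundary of a boundary vanishes: turning at `u` carries the face of each incoming dart to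
    -- that of the next outgoing one, so both halves of the sum at `u` agree after reindexing by the
    -- rotation.
    ∂-circulation : ∀ h → Circulation (∂ h)
    ∂-circulation h .antisymmetric u v =
      trans (cong (_* (h (face (u , v)) - h (face (v , u)))) (α-sym u v))
            (flip (α v u) (h (face (u , v))) (h (face (v , u))))
      where
      flip : ∀ a b c → a * (b - c) ≡ - (a * (c - b))
      flip a b c = solve (a ∷ b ∷ c ∷ [])
    ∂-circulation h .supported {u} {v} u≁v =
      cong (_* (h (face (u , v)) - h (face (v , u)))) (𝟙-false (u ~? v) u≁v)
    ∂-circulation h .conserved u = begin
      sum (∂ h u)
        ≡⟨ sum-cong (λ v → distrib (α u v) _ _) ⟩
      sum (λ v → α u v * h (face (u , v)) - α u v * h (face (v , u)))
        ≡⟨ sum-sub _ _ ⟩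
      sum (λ v → α u v * h (face (u , v))) - sum (λ v → α u v * h (face (v , u)))
        ≡⟨ cong (_- sum (λ v → α u v * h (face (v , u))))
             (trans (sum-permute _ (rot⁺-permutation u)) (sum-cong rotate)) ⟩
      sum (λ v → α u v * h (face (v , u))) - sum (λ v → α u v * h (face (v , u)))
        ≡⟨ ℤ.+-inverseʳ (sum (λ v → α u v * h (face (v , u)))) ⟩
      0ℤ ∎
      where
      distrib : ∀ a b c → a * (b - c) ≡ a * b - a * c
      distrib a b c = solve (a ∷ b ∷ c ∷ [])
      rotate : ∀ v → α u (rot⁺ u v) * h (face (u , rot⁺ u v)) ≡ α u v * h (face (v , u))
      rotate v with u ~? v
      ... | yes u~v = cong₂ _*_ (𝟙-true (u ~? rot u v) (rot-closed u~v)) (cong h (face-rot u~v))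
      ... | no u≁v  = cong (_* h (face (u , v))) (𝟙-false (u ~? v) u≁v)

    combination-circulation : ∀ {y z} c → Circulation y → Circulation z →
                              Circulation (λ u v → c * y u v - z u v)
    combination-circulation {y} {z} c Y Z = record
      { antisymmetric = λ u v → trans (cong₂ (λ a b → c * a - b) (antisymmetric Y u v) (antisymmetric Z u v))
                                      (neg c (y v u) (z v u))
      ; supported     = λ u≁v → trans (cong₂ (λ a b → c * a - b) (supported Y u≁v) (supported Z u≁v)) (zeros c)
      ; conserved     = λ u → trans (sum-sub _ _) (trans
          (cong₂ _-_ (trans (sym (*-sum c (y u))) (cong (c *_) (conserved Y u))) (conserved Z u)) (zeros c))
      }
      where
      neg : ∀ c a b → c * - a - - b ≡ - (c * a - b)
      neg c a b = solve (c ∷ a ∷ b ∷ [])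
      zeros : ∀ c → c * 0ℤ - 0ℤ ≡ 0ℤ
      zeros c = solve (c ∷ [])

    -- Summation by parts: collecting the terms with a fixed value of `g` leaves that value times
    -- the net flow at one vertex.
    gradient-orthogonal : ∀ {y} → Circulation y → (g : Vertex G → ℤ) →
                          sum (λ u → sum (λ v → (g v - g u) * y u v)) ≡ 0ℤ
    gradient-orthogonal {y} Y g = begin
      sum (λ u → sum (λ v → (g v - g u) * y u v))
        ≡⟨ sum-cong (λ u → trans (sum-cong (λ v → distrib (g v) (g u) (y u v))) (sum-sub _ _)) ⟩
      sum (λ u → sum (λ v → g v * y u v) - sum (λ v → g u * y u v))
        ≡⟨ sum-sub _ _ ⟩
      sum (λ u → sum (λ v → g v * y u v)) - sum (λ u → sum (λ v → g u * y u v))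
        ≡⟨ cong₂ _-_ (trans (sum-comm (λ u v → g v * y u v))
                              (sum-zero λ v → pull (g v) (λ u → y u v) (conservedʳ Y v)))
                     (sum-zero λ u → pull (g u) (y u) (conserved Y u)) ⟩
      0ℤ ∎
      where
      distrib : ∀ a b c → (a - b) * c ≡ a * c - b * c
      distrib a b c = solve (a ∷ b ∷ c ∷ [])
      pull : ∀ a (f : Vertex G → ℤ) → sum f ≡ 0ℤ → sum (λ u → a * f u) ≡ 0ℤ
      pull a f f≡0 = trans (sym (*-sum a f)) (trans (cong (a *_) f≡0) (ℤ.*-zeroʳ a))

    -- By orthogonality the squares of the differences of `g` over all darts add up to zero, so over
    -- the integers each of them is zero.
    gradient-circulation⇒flat : ∀ {y} → Circulation y → (g : Vertex G → ℤ) →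
                                (∀ {u v} → u ~ v → y u v ≡ g v - g u) → ∀ {u v} → u ~ v → g v ≡ g u
    gradient-circulation⇒flat {y} Y g y≡δg {u} {v} u~v =
      ℤ.i-j≡0⇒i≡j (g v) (g u) (i*i≡0⇒i≡0 (g v - g u) (trans (cong ((g v - g u) *_) (sym (y≡δg u~v)))
        (sum≡0⇒all≡0 (term≥0 u) (sum≡0⇒all≡0 (λ u → sum-nonneg (term≥0 u)) (gradient-orthogonal Y g) u) v)))
      where
      term≥0 : ∀ u v → 0ℤ ≤ (g v - g u) * y u v
      term≥0 u v with u ~? v
      ... | yes u~v = subst (λ a → 0ℤ ≤ (g v - g u) * a) (sym (y≡δg u~v)) (0≤i*i (g v - g u))
      ... | no u≁v  = ℤ.≤-reflexive (sym (trans (cong ((g v - g u) *_) (supported Y u≁v)) (ℤ.*-zeroʳ (g v - g u))))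

    flat⇒constant : (g : Vertex G → ℤ) → (∀ {u v} → u ~ v → g v ≡ g u) → ∀ u v → g v ≡ g u
    flat⇒constant g flat u v = along (connected {u} {v} ∈⊤ ∈⊤)
      where
      along : ∀ {u v} → Star (Graph.InducedAdj G _) u v → g v ≡ g u
      along ε = refl
      along ((_ , _ , u~w) ◅ p) = trans (along p) (flat u~w)

    -- The dart after `(u , w)` in the rotation at `u` lies on the face of `(w , u)`, which `loc`
    -- compares with the face of `(u , w)`.
    around-constant : (h : Face → ℤ) → ∀ {u} → (∀ {w} → u ~ w → h (face (u , w)) ≡ h (face (w , u))) →
                      ∀ {w w′} → u ~ w → u ~ w′ → h (face (u , w)) ≡ h (face (u , w′))
    around-constant h {u} loc {w} u~w u~w′ =
      rotation-induction (λ w′ → h (face (u , w)) ≡ h (face (u , w′)))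
        (λ u~w′ eq → trans eq (trans (loc u~w′) (cong h (sym (face-rot u~w′))))) u~w u~w′ refl

    -- This is connectedness of the dual graph: `h` is constant around each vertex, and a walk in
    -- `G` carries its value from vertex to vertex.
    locally-constant⇒constant : (h : Face → ℤ) → (∀ {u v} → u ~ v → h (face (u , v)) ≡ h (face (v , u))) →
                                ∀ f f′ → h f ≡ h f′
    locally-constant⇒constant h loc f f′
      with (u , w) , u~w , refl ← face-onto f | (v , w′) , v~w′ , refl ← face-onto f′ =
      along (connected {u} {v} ∈⊤ ∈⊤) u~w v~w′
      where
      around : ∀ {u w w′} → u ~ w → u ~ w′ → h (face (u , w)) ≡ h (face (u , w′))
      around u~w u~w′ = around-constant h loc u~w u~w′
      along : ∀ {u v w w′} → Star (Graph.InducedAdj G _) u v → u ~ w → v ~ w′ → h (face (u , w)) ≡ h (face (v , w′))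
      along ε u~w v~w′ = around u~w v~w′
      along ((_ , _ , u~m) ◅ p) u~w v~w′ = trans (around u~w u~m) (trans (loc u~m) (along p (~-sym u~m) v~w′))

    -- The first homology of the sphere vanishes, up to the scalar c: with the
    -- normalisations g root = 0 and h f₀ = 0 the equations c z = ∂ h + δ g on
    -- the edges are E + 2 in V + F + 1 = E + 3 unknowns c, g, h.  As δ g is then a
    -- circulation, it is orthogonal to itself, so g is constant.
    circulation-bounds : ∀ {z} → Circulation z → Face →
      ∃[ c ] ∃[ h ] c ≢ 0ℤ × (∀ {u v} → u ~ v → c * z u v ≡ h (face (u , v)) - h (face (v , u)))
    circulation-bounds {z} Z f₀ = c , h , c≢0 , c*z≡∂h
      where
      root = proj₁ (proj₁ (face-onto f₀))

      edges = filter (λ (u , v) → (u <? v) ×-dec (u ~? v)) vertexPairs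

      N = suc (V ℕ.+ #faces)
      cᵢ : Fin N
      cᵢ = zero
      gᵢ : Vertex G → Fin N
      gᵢ v = suc (v ↑ˡ #faces)
      hᵢ : Face → Fin N
      hᵢ f = suc (V ↑ʳ f)

      edgeEquation : Vertex G × Vertex G → (Fin N → ℤ) → ℤ
      edgeEquation (u , v) x =
        (x cᵢ * z u v - (x (hᵢ (face (u , v))) - x (hᵢ (face (v , u))))) - (x (gᵢ v) - x (gᵢ u))

      equations : Fin (2 ℕ.+ size G) → (Fin N → ℤ) → ℤ
      -- A constant `g` with `h` zero, or a constant `h` with `g` zero, solves every edge equation
      -- with c = 0; the first two equations rule these out.
      equations zero          x = x (gᵢ root)
      equations (suc zero)    x = x (hᵢ f₀)
      equations (suc (suc e)) x = edgeEquation (lookup edges e) x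

      linear : ∀ i → IsLinear (equations i)
      linear zero          = coordinate-linear _
      linear (suc zero)    = coordinate-linear _
      linear (suc (suc e)) = minus-linear
        (minus-linear (scale-linear (coordinate-linear cᵢ) _)
                      (minus-linear (coordinate-linear _) (coordinate-linear _)))
        (minus-linear (coordinate-linear _) (coordinate-linear _))

      fewer : 2 ℕ.+ size G ℕ.< N
      fewer = s≤s (ℕ.≤-reflexive (trans (ℕ.+-comm 2 (size G)) (sym euler)))

      solution = nontrivialZero equations linear fewer
      x   = proj₁ solution
      x≢0 = proj₁ (proj₂ solution)
      x-solves = proj₂ (proj₂ solution)

      c = x cᵢ
      g : Vertex G → ℤ
      g v = x (gᵢ v)
      h : Face → ℤ
      h f = x (hᵢ f)

      y : Vertex G → Vertex G → ℤ
      y u v = c * z u v - ∂ h u v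
      Y : Circulation y
      Y = combination-circulation c Z (∂-circulation h)

      y≡ : ∀ {u v} → u ~ v → y u v ≡ c * z u v - (h (face (u , v)) - h (face (v , u)))
      y≡ {u} {v} u~v = cong (_-_ (c * z u v)) (trans
        (cong (_* (h (face (u , v)) - h (face (v , u)))) (𝟙-true (u ~? v) u~v)) (ℤ.*-identityˡ _))

      y≡δg-ordered : ∀ {u v} → u Fin.< v → u ~ v → y u v ≡ g v - g u
      y≡δg-ordered {u} {v} u<v u~v = trans (y≡ u~v) (ℤ.i-j≡0⇒i≡j _ _
        (subst (λ e → edgeEquation e x ≡ 0ℤ) (sym (lookup-index uv∈)) (x-solves (suc (suc (index uv∈))))))
        where
        uv∈ : (u , v) List.∈ edges
        uv∈ = ∈-filter⁺ _ (∈-cartesianProduct⁺ (∈-allFin u) (∈-allFin v)) (u<v , u~v)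

      y≡δg : ∀ {u v} → u ~ v → y u v ≡ g v - g u
      y≡δg {u} {v} u~v with <-cmp u v
      ... | tri< u<v _ _ = y≡δg-ordered u<v u~v
      ... | tri≈ _ u≡v _ = contradiction u~v (~-irrefl u≡v)
      ... | tri> _ _ v<u = trans (antisymmetric Y u v)
              (trans (cong -_ (y≡δg-ordered v<u (~-sym u~v))) (flip (g u) (g v)))
        where
        flip : ∀ a b → - (a - b) ≡ b - a
        flip a b = solve (a ∷ b ∷ [])

      g≡0 : ∀ v → g v ≡ 0ℤ
      g≡0 v = trans (flat⇒constant g (gradient-circulation⇒flat Y g y≡δg) root v) (x-solves zero)

      c*z≡∂h : ∀ {u v} → u ~ v → c * z u v ≡ h (face (u , v)) - h (face (v , u))
      c*z≡∂h {u} {v} u~v = ℤ.i-j≡0⇒i≡j _ _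
        (trans (sym (y≡ u~v)) (trans (y≡δg u~v) (cong₂ _-_ (g≡0 v) (g≡0 u))))

      -- If c = 0 then `h` has no jump across any edge, so it is constant and vanishes with its
      -- value at `f₀`. As `g` vanishes too, the whole solution would be zero.
      c≢0 : c ≢ 0ℤ
      c≢0 c≡0 = proj₂ x≢0 (x≡0 (proj₁ x≢0))
        where
        h≡0 : ∀ f → h f ≡ 0ℤ
        h≡0 f = trans (locally-constant⇒constant h
          (λ {u} {v} u~v → ℤ.i-j≡0⇒i≡j _ _ (trans (sym (c*z≡∂h u~v)) (cong (_* z u v) c≡0))) f f₀)
          (x-solves (suc zero))
        x≡0 : ∀ j → x j ≡ 0ℤ
        x≡0 zero    = c≡0
        x≡0 (suc j) = subst (λ j → x (suc j) ≡ 0ℤ) (join-splitAt V #faces j) (vanishes (splitAt V j))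
          where
          vanishes : ∀ k → x (suc (join V #faces k)) ≡ 0ℤ
          vanishes (inj₁ v) = g≡0 v
          vanishes (inj₂ f) = h≡0 f

    -- Closed walks as circulations

    arc : Vertex G → Vertex G → Vertex G → Vertex G → ℤ
    arc a b u v = δ a u * δ b v - δ a v * δ b u

    arc-avoid : ∀ {a b u} → a ≢ u → b ≢ u → ∀ v → arc a b u v ≡ 0ℤ
    arc-avoid {a} {b} {u} a≢u b≢u v = cong₂ _-_
      (cong (_* δ b v) (𝟙-false (a ≟ u) a≢u))
      (trans (cong (δ a v *_) (𝟙-false (b ≟ u) b≢u)) (ℤ.*-zeroʳ (δ a v)))

    -- The flow along a walk counts edges with sign and multiplicity, so walks with repetitions are
    -- allowed.
    chain : ∀ {s t} → Star _~_ s t → Vertex G → Vertex G → ℤ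
    chain ε u v = 0ℤ
    chain (_◅_ {s} {m} _ p) u v = arc s m u v + chain p u v

    chain-antisymmetric : ∀ {s t} (p : Star _~_ s t) u v → chain p u v ≡ - chain p v u
    chain-antisymmetric ε u v = refl
    chain-antisymmetric (_◅_ {s} {m} _ p) u v = begin
      arc s m u v + chain p u v      ≡⟨ cong (_+_ (arc s m u v)) (chain-antisymmetric p u v) ⟩
      arc s m u v - chain p v u      ≡⟨ flip (δ s u) (δ m v) (δ s v) (δ m u) (chain p v u) ⟩
      - (arc s m v u + chain p v u)  ∎
      where
      flip : ∀ a b c d e → (a * b - c * d) - e ≡ - ((c * d - a * b) + e)
      flip a b c d e = solve (a ∷ b ∷ c ∷ d ∷ e ∷ [])

    chain-supported : ∀ {s t} (p : Star _~_ s t) {u v} → ¬ u ~ v → chain p u v ≡ 0ℤ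
    chain-supported ε u≁v = refl
    chain-supported (_◅_ {s} {m} s~m p) {u} {v} u≁v = cong₂ _+_
      (cong₂ _-_ (vanish u v u≁v) (vanish v u (u≁v ∘ ~-sym))) (chain-supported p u≁v)
      where
      vanish : ∀ u v → ¬ u ~ v → δ s u * δ m v ≡ 0ℤ
      vanish u v u≁v with s ≟ u
      ... | no _     = refl
      ... | yes refl = cong (1ℤ *_) (𝟙-false (m ≟ v) λ { refl → u≁v s~m })

    -- The net outflows of consecutive steps telescope; for a closed walk the two ends cancel.
    chain-boundary : ∀ {s t} (p : Star _~_ s t) u → sum (chain p u) ≡ δ s u - δ t u
    chain-boundary {s} ε u = trans (sum-zero λ _ → refl) (sym (ℤ.+-inverseʳ (δ s u)))
    chain-boundary {s} {t} (_◅_ {s} {m} _ p) u = begin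
      sum (λ v → arc s m u v + chain p u v)
        ≡⟨ sum-+ (arc s m u) (chain p u) ⟩
      sum (arc s m u) + sum (chain p u)
        ≡⟨ cong₂ _+_ (sum-sub (λ v → δ s u * δ m v) (λ v → δ s v * δ m u)) (chain-boundary p u) ⟩
      (sum (λ v → δ s u * δ m v) - sum (λ v → δ s v * δ m u)) + (δ m u - δ t u)
        ≡⟨ cong (_+ (δ m u - δ t u)) (cong₂ _-_
             (trans (sum-cong (λ v → ℤ.*-comm (δ s u) (δ m v))) (sum-δ m (λ _ → δ s u)))
             (sum-δ s (λ _ → δ m u))) ⟩
      (δ s u - δ m u) + (δ m u - δ t u)
        ≡⟨ telescope (δ s u) (δ m u) (δ t u) ⟩
      δ s u - δ t u ∎
      where
      telescope : ∀ a b c → (a - b) + (b - c) ≡ a - c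
      telescope a b c = solve (a ∷ b ∷ c ∷ [])

    closed-walk-circulation : ∀ {s} (p : Star _~_ s s) → Circulation (chain p)
    closed-walk-circulation {s} p = record
      { antisymmetric = chain-antisymmetric p
      ; supported     = chain-supported p
      ; conserved     = λ u → trans (chain-boundary p u) (ℤ.+-inverseʳ (δ s u))
      }

    -- It has the same shape as `InducedAdj`, so steps inside a branch set of the cone that avoid
    -- the apex carry over unchanged.
    Within : (Vertex G → Set) → Vertex G → Vertex G → Set
    Within A u v = A u × A v × u ~ v

    IsConnected : (Vertex G → Set) → Set
    IsConnected A = ∀ {u v} → A u → A v → Star (Within A) u v

    walk : ∀ {A s t} → Star (Within A) s t → Star _~_ s t
    walk = Star.map (proj₂ ∘ proj₂)

    chain-avoid : ∀ {A s t} (p : Star (Within A) s t) {u} → ¬ A u → ∀ v → chain (walk p) u v ≡ 0ℤ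
    chain-avoid ε ¬Au v = refl
    chain-avoid (_◅_ {s} {m} (As , Am , _) p) ¬Au v =
      cong₂ _+_ (arc-avoid {s} {m} (λ { refl → ¬Au As }) (λ { refl → ¬Au Am }) v) (chain-avoid p ¬Au v)

    -- A bounding 4-cycle listed in the direction in which the face is traced, which
    -- `BoundedByCycle` leaves open.
    record FacialQuad (f : Face) (y : Fin 4 → Vertex G) : Set where
      field
        injective : Injective _≡_ _≡_ y
        adjacent  : ∀ i → y i ~ y (next i)
        turn      : ∀ i → rot (y (next i)) (y i) ≡ y (next (next i))
        on-face   : ∀ i → face (y i , y (next i)) ≡ f
        darts     : ∀ {u v} → u ~ v → face (u , v) ≡ f → ∃[ i ] u ≡ y i × v ≡ y (next i)

    -- A nonzero multiple κ z of the circulation z along y₂, y₁, y₀ and back to y₂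
    -- within A is the boundary of some h : Face → ℤ.  Then h is constant around each
    -- vertex of B other than y₁, whereas around y₁ it differs by κ from h f on every
    -- dart other than y₁ → y₂.
    quad-separates : ∀ {f y} → FacialQuad f y → (A B : Vertex G → Set) → (∀ {v} → A v → ¬ B v) →
      IsConnected A → A (y 0F) → A (y 2F) → IsConnected B → B (y 1F) → B (y 3F) → ⊥
    quad-separates {f} {y} Q A B disjoint A-conn Aa Ac B-conn Bb Bd =
      let _ , h , κ≢0 , κz≡∂h = circulation-bounds (closed-walk-circulation loop) f in refute h κ≢0 κz≡∂h
      where
      open FacialQuad Q
      a = y 0F
      b = y 1F
      c = y 2F
      d = y 3F

      d≢b : d ≢ b
      d≢b eq with () ← injective eq

      p = A-conn Aa Ac

      loop : Star _~_ c c
      loop = ~-sym (adjacent 1F) ◅ ~-sym (adjacent 0F) ◅ walk p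

      z : Vertex G → Vertex G → ℤ
      z = chain loop

      B≢ : ∀ {u v} → A u → B v → u ≢ v
      B≢ Au Bv refl = disjoint Au Bv

      z-off : ∀ {v} → B v → v ≢ b → ∀ w → z v w ≡ 0ℤ
      z-off Bv v≢b w = cong₂ _+_ (arc-avoid {c} {b} (B≢ Ac Bv) (v≢b ∘ sym) w)
        (cong₂ _+_ (arc-avoid {b} {a} (v≢b ∘ sym) (B≢ Aa Bv) w) (chain-avoid p (λ Av → disjoint Av Bv) w))

      arcs-at-b : ∀ w → z b w ≡ δ a w - δ c w
      arcs-at-b w = begin
        (δ c b * δ b w - δ c w * δ b b) + ((δ b b * δ a w - δ b w * δ a b) + chain (walk p) b w)
          ≡⟨ cong₂ _+_
               (cong₂ (λ i j → i * δ b w - δ c w * j) (𝟙-false (c ≟ b) (B≢ Ac Bb)) (𝟙-true (b ≟ b) refl))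
               (cong₂ _+_
                 (cong₂ (λ i j → i * δ a w - δ b w * j) (𝟙-true (b ≟ b) refl) (𝟙-false (a ≟ b) (B≢ Aa Bb)))
                 (chain-avoid p (λ Ab → disjoint Ab Bb) w)) ⟩
        (0ℤ * δ b w - δ c w * 1ℤ) + ((1ℤ * δ a w - δ b w * 0ℤ) + 0ℤ)
          ≡⟨ simplify (δ a w) (δ b w) (δ c w) ⟩
        δ a w - δ c w ∎
        where
        simplify : ∀ i j k → (0ℤ * j - k * 1ℤ) + ((1ℤ * i - j * 0ℤ) + 0ℤ) ≡ i - k
        simplify i j k = solve (i ∷ j ∷ k ∷ [])

      z-at-b : ∀ {w} → w ≢ a → w ≢ c → z b w ≡ 0ℤ
      z-at-b {w} w≢a w≢c = trans (arcs-at-b w)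
        (cong₂ _-_ (𝟙-false (a ≟ w) (w≢a ∘ sym)) (𝟙-false (c ≟ w) (w≢c ∘ sym)))

      z-bc : z b c ≡ - 1ℤ
      z-bc = trans (arcs-at-b c) (cong₂ _-_ (𝟙-false (a ≟ c) a≢c) (𝟙-true (c ≟ c) refl))
        where
        a≢c : a ≢ c
        a≢c eq with () ← injective eq

      refute : ∀ {κ} (h : Face → ℤ) → κ ≢ 0ℤ →
               (∀ {u v} → u ~ v → κ * z u v ≡ h (face (u , v)) - h (face (v , u))) → ⊥
      refute {κ} h κ≢0 κz≡∂h = meet (B-conn Bd Bb) Bd d≢b hf-at-d
        where
        no-jump : ∀ {u v} → u ~ v → z u v ≡ 0ℤ → h (face (u , v)) ≡ h (face (v , u))
        no-jump u~v z≡0 = ℤ.i-j≡0⇒i≡j _ _ (trans (sym (κz≡∂h u~v)) (trans (cong (κ *_) z≡0) (ℤ.*-zeroʳ κ)))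

        -- The exception is the dart from b to c, which lies on `f` itself. Making it a disjunct
        -- gives an invariant of the full rotation at b.
        Jumped : Vertex G → Set
        Jumped w = w ≡ c ⊎ h (face (b , w)) ≡ h f + κ

        around-b : ∀ {w} → b ~ w → Jumped w
        around-b b~w = rotation-induction Jumped step (adjacent 1F) b~w (inj₁ refl)
          where
          jump : h (face (c , b)) ≡ h f + κ
          jump = begin
            h (face (c , b))
              ≡⟨ rearrange _ (h (face (b , c))) ⟩
            h (face (b , c)) - (h (face (b , c)) - h (face (c , b)))
              ≡⟨ cong₂ _-_ (cong h (on-face 1F)) (trans (sym (κz≡∂h (adjacent 1F))) (cong (κ *_) z-bc)) ⟩
            h f - κ * - 1ℤ
              ≡⟨ cancel (h f) κ ⟩
            h f + κ ∎
            where
            rearrange : ∀ i j → i ≡ j - (j - i)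
            rearrange i j = solve (i ∷ j ∷ [])
            cancel : ∀ i k → i - k * - 1ℤ ≡ i + k
            cancel i k = solve (i ∷ k ∷ [])
          step : ∀ {w} → b ~ w → Jumped w → Jumped (rot b w)
          step b~w (inj₁ refl) = inj₂ (trans (cong h (face-rot b~w)) jump)
          step {w} b~w (inj₂ eq) with w ≟ a | w ≟ c
          -- At b the face `f` turns from a to c, so the rotation passes from the dart to a directly
          -- to the excepted dart.
          ... | yes refl | _        = inj₁ (turn 0F)
          ... | no _     | yes refl = inj₂ (trans (cong h (face-rot b~w)) jump)
          ... | no w≢a   | no w≢c   =
            inj₂ (trans (cong h (face-rot b~w)) (trans (sym (no-jump b~w (z-at-b w≢a w≢c))) eq))

        hf-at-d : ∀ {w} → d ~ w → h (face (d , w)) ≡ h f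
        hf-at-d d~w = trans (around-constant h (λ {w} d~w → no-jump d~w (z-off Bd d≢b w)) d~w (adjacent 3F))
                            (cong h (on-face 3F))

        -- The walk in B from d is followed until it first enters b. Up to there `h` keeps the value
        -- `h f` that it has at d. The entering edge comes from a vertex of B, hence not from c, and
        -- `z` vanishes on it; but at b its value is `h f + κ`.
        meet : ∀ {v} → Star (Within B) v b → B v → v ≢ b → (∀ {w} → v ~ w → h (face (v , w)) ≡ h f) → ⊥
        meet ε _ v≢b _ = v≢b refl
        meet {v} (_◅_ {_} {m} (_ , Bm , v~m) q) Bv v≢b hv with m ≟ b
        ... | no m≢b = meet q Bm m≢b λ m~w →
          trans (around-constant h (λ {w} m~w → no-jump m~w (z-off Bm m≢b w)) m~w (~-sym v~m))
                (trans (no-jump (~-sym v~m) (z-off Bm m≢b v)) (hv v~m))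
        ... | yes refl with around-b (~-sym v~m)
        ... | inj₁ v≡c = B≢ Ac Bv (sym v≡c)
        ... | inj₂ eq  = κ≢0 (begin
          κ              ≡⟨ cancel (h f) κ ⟩
          (h f + κ) - h f ≡⟨ cong₂ _-_ (trans (sym eq) (trans (sym (no-jump v~m (z-off Bv v≢b b))) (hv v~m))) refl ⟩
          h f - h f      ≡⟨ ℤ.+-inverseʳ (h f) ⟩
          0ℤ             ∎)
          where
          cancel : ∀ i k → k ≡ (i + k) - i
          cancel i k = solve (i ∷ k ∷ [])

    -- Orienting the bounding cycle

    private
      next⁴ : ∀ (i : Fin 4) → next (next (next (next i))) ≡ i
      next⁴ 0F = refl
      next⁴ 1F = refl
      next⁴ 2F = refl
      next⁴ 3F = refl

      next-injective : ∀ {i j : Fin 4} → next i ≡ next j → i ≡ j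
      next-injective {i} {j} eq = trans (sym (next⁴ i)) (trans (cong (next ∘ next ∘ next) eq) (next⁴ j))

      next²≢ : ∀ (i : Fin 4) → next (next i) ≢ i
      next²≢ 0F ()
      next²≢ 1F ()
      next²≢ 2F ()
      next²≢ 3F ()

      next-opposite-next : ∀ (i : Fin 4) → next (opposite (next i)) ≡ opposite i
      next-opposite-next 0F = refl
      next-opposite-next 1F = refl
      next-opposite-next 2F = refl
      next-opposite-next 3F = refl

    -- One side traced forwards fixes the direction of all: tracing must continue along the cycle,
    -- and since a face is a single orbit, every dart of `f` is met on the way.
    facialQuad : ∀ {f x} → Injective _≡_ _≡_ x → (∀ i → x i ~ x (next i)) →
                 (∀ {u v} → u ~ v → face (u , v) ≡ f → CycleEdge x u v) →
                 face (x 1F , x 2F) ≡ f → FacialQuad f x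
    facialQuad {f} {x} inj adj boundary start = record
      { injective = inj
      ; adjacent  = adj
      ; turn      = λ i → turn i (on-face i)
      ; on-face   = on-face
      ; darts     = darts
      }
      where
      turn : ∀ i → face (x i , x (next i)) ≡ f → rot (x (next i)) (x i) ≡ x (next (next i))
      turn i on with boundary (rot-closed (~-sym (adj i))) (trans (face-rot (~-sym (adj i))) on)
      ... | j , inj₁ (eq , eq′) = trans eq′ (cong (x ∘ next) (sym (inj eq)))
      -- Turning back would make `x i` a fixed point of the rotation and thus the only neighbour of
      -- `x (next i)`, but `x (next (next i))` is another one.
      ... | j , inj₂ (eq , eq′) = contradiction (inj (rotation-induction (_≡ x i)
              (λ { _ refl → trans eq (cong x (sym (next-injective (inj eq′)))) })
              (~-sym (adj i)) (adj (next i)) refl)) (next²≢ i)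

      step : ∀ i → face (x i , x (next i)) ≡ f → face (x (next i) , x (next (next i))) ≡ f
      step i on = trans (cong (λ w → face (x (next i) , w)) (sym (turn i on))) (trans (face-rot (~-sym (adj i))) on)

      on-face : ∀ i → face (x i , x (next i)) ≡ f
      on-face 1F = start
      on-face 2F = step 1F start
      on-face 3F = step 2F (step 1F start)
      on-face 0F = step 3F (step 2F (step 1F start))

      traced : ∀ k i → ∃[ j ] iterate trace (x i , x (next i)) k ≡ (x j , x (next j))
      traced zero    i = i , refl
      traced (suc k) i with j , eq ← traced k (next i) =
        j , trans (cong (λ w → iterate trace (x (next i) , w) k) (turn i (on-face i))) eq

      darts : ∀ {u v} → u ~ v → face (u , v) ≡ f → ∃[ i ] u ≡ x i × v ≡ x (next i)
      darts u~v on with k , eq ← Equivalence.to (face-orbit (adj 1F) u~v) (trans start (sym on))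
        with j , eq′ ← traced k 1F =
        let eq″ = trans (sym eq) eq′ in j , cong proj₁ eq″ , cong proj₂ eq″

    -- The face lies on at least one side of the edge between `x 1F` and `x 2F`, and the side
    -- decides the direction. This edge is chosen because `opposite` exchanges 1F and 2F, so both
    -- cases start at the same indices.
    facialQuad-bounded : ∀ {f x} → BoundedByCycle f x → FacialQuad f x ⊎ FacialQuad f (x ∘ opposite)
    facialQuad-bounded {f} {x} (cycle , boundary) = [ inj₁ ∘ forward , inj₂ ∘ backward ]′
        (Equivalence.from (boundary (adjacent 1F)) (1F , inj₁ (refl , refl)))
      where
      open IsCycle cycle
      forward : face (x 1F , x 2F) ≡ f → FacialQuad f x
      forward = facialQuad injective adjacent (λ u~v on → Equivalence.to (boundary u~v) (inj₁ on))

      reversed : ∀ {u v} → CycleEdge x u v → CycleEdge (x ∘ opposite) u v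
      reversed (i , uv) = opposite (next i) ,
        [ (λ (u≡ , v≡) → inj₂ (trans v≡ end₁ , trans u≡ end₂))
        , (λ (v≡ , u≡) → inj₁ (trans u≡ end₁ , trans v≡ end₂)) ]′ uv
        where
        end₁ : x (next i) ≡ x (opposite (opposite (next i)))
        end₁ = cong x (sym (opposite-involutive (next i)))
        end₂ : x i ≡ x (opposite (next (opposite (next i))))
        end₂ = cong x (trans (sym (opposite-involutive i)) (cong opposite (sym (next-opposite-next i))))

      backward : face (x 2F , x 1F) ≡ f → FacialQuad f (x ∘ opposite)
      backward = facialQuad
        (λ eq → trans (sym (opposite-involutive _)) (trans (cong opposite (injective eq)) (opposite-involutive _)))
        (λ i → ~-sym (subst (λ j → x (opposite (next i)) ~ x j) (next-opposite-next i) (adjacent (opposite (next i)))))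
        (λ u~v on → reversed (Equivalence.to (boundary u~v) (inj₁ on)))

    quadrilateral-separates : ∀ {f x} → BoundedByCycle f x → (A B : Vertex G → Set) → (∀ {v} → A v → ¬ B v) →
      IsConnected A → A (x 0F) → A (x 2F) → IsConnected B → B (x 1F) → B (x 3F) → ⊥
    quadrilateral-separates bounded A B disjoint A-conn A₀ A₂ B-conn B₁ B₃ with facialQuad-bounded bounded
    ... | inj₁ Q = quad-separates Q A B disjoint A-conn A₀ A₂ B-conn B₁ B₃
    -- Reversal exchanges even and odd corners, so A and B trade roles.
    ... | inj₂ Q = quad-separates Q B A (λ Bv Av → disjoint Av Bv) B-conn B₃ B₁ A-conn A₂ A₀

  -- Counting edges and faces

  𝟙-× : ∀ {P Q : Set} (P? : Dec P) (Q? : Dec Q) → 𝟙 (P? ×-dec Q?) ≡ 𝟙 P? * 𝟙 Q?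
  𝟙-× (yes _) Q? = sym (ℤ.*-identityˡ (𝟙 Q?))
  𝟙-× (no _)  Q? = refl

  sum-const : ∀ {n} a → sum {n} (λ _ → a) ≡ + n * a
  sum-const {zero}  a = sum-[] _
  sum-const {suc n} a = trans (sum-∷ {n} (λ _ → a)) (trans (cong (_+_ a) (sum-const {n} a)) (sym (ℤ.suc-* (+ n) a)))

  length-filter-tabulate : ∀ {A : Set} {P : Pred A 0ℓ} (P? : Decidable P) {n} (f : Fin n → A) →
                           + length (filter P? (tabulate f)) ≡ sum (λ i → 𝟙 (P? (f i)))
  length-filter-tabulate P? {zero}  f = sym (sum-[] _)
  length-filter-tabulate P? {suc n} f = trans step (sym (sum-∷ (λ i → 𝟙 (P? (f i)))))
    where
    step : + length (filter P? (tabulate f)) ≡ 𝟙 (P? (f zero)) + sum (λ i → 𝟙 (P? (f (suc i))))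
    step with P? (f zero)
    ... | yes _ = cong (_+_ 1ℤ) (length-filter-tabulate P? (f ∘ suc))
    ... | no _  = trans (length-filter-tabulate P? (f ∘ suc)) (sym (ℤ.+-identityˡ _))

  length-filter-pairs : ∀ {m n} {P : Pred (Fin m × Fin n) 0ℓ} (P? : Decidable P) →
    + length (filter P? (cartesianProduct (allFin m) (allFin n))) ≡ sum (λ u → sum (λ v → 𝟙 (P? (u , v))))
  length-filter-pairs {m} {n} P? = rows (λ u → u)
    where
    -- The first factor is generalised from `allFin` to `tabulate f`, the form its tail takes in the
    -- induction.
    rows : ∀ {k} (f : Fin k → Fin m) →
      + length (filter P? (cartesianProduct (tabulate f) (allFin n))) ≡ sum (λ i → sum (λ v → 𝟙 (P? (f i , v))))
    rows {zero}  f = sym (sum-[] _)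
    rows {suc k} f = begin
      + length (filter P? (row ++ rest))
        ≡⟨ cong (+_ ∘ length) (filter-++ P? row rest) ⟩
      + length (filter P? row ++ filter P? rest)
        ≡⟨ cong +_ (length-++ (filter P? row)) ⟩
      + length (filter P? row) + + length (filter P? rest)
        ≡⟨ cong₂ _+_ (trans (cong (λ l → + length (filter P? l)) (map-tabulate (λ v → v) (f zero ,_)))
                            (length-filter-tabulate P? (f zero ,_)))
                     (rows (f ∘ suc)) ⟩
      sum (λ v → 𝟙 (P? (f zero , v))) + sum (λ i → sum (λ v → 𝟙 (P? (f (suc i) , v))))
        ≡⟨ sym (sum-∷ (λ i → sum (λ v → 𝟙 (P? (f i , v))))) ⟩
      sum (λ i → sum (λ v → 𝟙 (P? (f i , v)))) ∎
      where
      row  = map (f zero ,_) (allFin n)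
      rest = cartesianProduct (tabulate (f ∘ suc)) (allFin n)

  module Degrees (G : Graph) where
    open Graph G using (_~_; _~?_; ~-sym; ~-irrefl)

    #darts : ℤ
    #darts = sum (λ u → sum (λ v → 𝟙 (u ~? v)))

    edge? : ∀ u v → Dec _
    edge? u v = (u <? v) ×-dec (u ~? v)

    size≡ : + size G ≡ sum (λ u → sum (λ v → 𝟙 (edge? u v)))
    size≡ = length-filter-pairs (λ (u , v) → edge? u v)

    -- Each edge is counted in its increasing order; exchanging the two sums counts it again as the
    -- decreasing dart.
    handshake : + size G + + size G ≡ #darts
    handshake = begin
      + size G + + size G
        ≡⟨ cong₂ _+_ size≡ (trans size≡ (sum-comm (λ u v → 𝟙 (edge? u v)))) ⟩
      sum (λ u → sum (λ v → 𝟙 (edge? u v))) + sum (λ u → sum (λ v → 𝟙 (edge? v u)))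
        ≡⟨ sym (sum-+ _ _) ⟩
      sum (λ u → sum (λ v → 𝟙 (edge? u v)) + sum (λ v → 𝟙 (edge? v u)))
        ≡⟨ sum-cong (λ u → trans (sym (sum-+ _ _)) (sum-cong (λ v → oriented u v))) ⟩
      #darts ∎
      where
      oriented : ∀ u v → 𝟙 (edge? u v) + 𝟙 (edge? v u) ≡ 𝟙 (u ~? v)
      oriented u v with <-cmp u v
      ... | tri< u<v _ v≮u = trans
        (cong₂ _+_ (𝟙-cong (edge? u v) (u ~? v) proj₂ (u<v ,_)) (𝟙-false (edge? v u) (v≮u ∘ proj₁)))
        (ℤ.+-identityʳ _)
      ... | tri≈ u≮v u≡v v≮u = trans
        (cong₂ _+_ (𝟙-false (edge? u v) (u≮v ∘ proj₁)) (𝟙-false (edge? v u) (v≮u ∘ proj₁)))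
        (sym (𝟙-false (u ~? v) (~-irrefl u≡v)))
      ... | tri> u≮v _ v<u = trans
        (cong₂ _+_ (𝟙-false (edge? u v) (u≮v ∘ proj₁))
                   (𝟙-cong (edge? v u) (u ~? v) (~-sym ∘ proj₂) (λ u~v → v<u , ~-sym u~v)))
        (ℤ.+-identityˡ _)

  -- The apex has the smallest index, so all spokes are counted in its row and the other rows
  -- reproduce those of `G`.
  size-cone : ∀ G → size (cone G) ≡ size G ℕ.+ order G
  size-cone G = ℤ.+-injective (begin
    + size (cone G)
      ≡⟨ C.size≡ ⟩
    sum (λ u → sum (λ v → 𝟙 (C.edge? u v)))
      ≡⟨ sum-∷ (λ u → sum (λ v → 𝟙 (C.edge? u v))) ⟩
    sum (λ v → 𝟙 (C.edge? zero v)) + sum (λ u → sum (λ v → 𝟙 (C.edge? (suc u) v)))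
      ≡⟨ cong₂ _+_ spokes (trans (sum-cong rim) (sym B.size≡)) ⟩
    + order G + + size G
      ≡⟨ ℤ.+-comm (+ order G) (+ size G) ⟩
    + (size G ℕ.+ order G) ∎)
    where
    module B = Degrees G
    module C = Degrees (cone G)

    spokes : sum (λ v → 𝟙 (C.edge? zero v)) ≡ + order G
    spokes = begin
      sum (λ v → 𝟙 (C.edge? zero v))
        ≡⟨ sum-∷ (λ v → 𝟙 (C.edge? zero v)) ⟩
      𝟙 (C.edge? zero zero) + sum (λ v → 𝟙 (C.edge? zero (suc v)))
        ≡⟨ cong₂ _+_ (𝟙-false (C.edge? zero zero) proj₂)
                     (sum-cong (λ v → 𝟙-true (C.edge? zero (suc v)) (z<s , tt))) ⟩
      0ℤ + sum {order G} (λ _ → 1ℤ)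
        ≡⟨ trans (ℤ.+-identityˡ _) (sum-const {order G} 1ℤ) ⟩
      + order G * 1ℤ
        ≡⟨ ℤ.*-identityʳ (+ order G) ⟩
      + order G ∎

    rim : ∀ u → sum (λ v → 𝟙 (C.edge? (suc u) v)) ≡ sum (λ v → 𝟙 (B.edge? u v))
    rim u = begin
      sum (λ v → 𝟙 (C.edge? (suc u) v))
        ≡⟨ sum-∷ (λ v → 𝟙 (C.edge? (suc u) v)) ⟩
      𝟙 (C.edge? (suc u) zero) + sum (λ v → 𝟙 (C.edge? (suc u) (suc v)))
        ≡⟨ cong₂ _+_ (𝟙-false (C.edge? (suc u) zero) λ ()) (sum-cong λ v →
             𝟙-cong (C.edge? (suc u) (suc v)) (B.edge? u v)
               (λ (u<v , u~v) → ℕ.s<s⁻¹ u<v , u~v) (λ (u<v , u~v) → s<s u<v , u~v)) ⟩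
      0ℤ + sum (λ v → 𝟙 (B.edge? u v))
        ≡⟨ ℤ.+-identityˡ _ ⟩
      sum (λ v → 𝟙 (B.edge? u v)) ∎

  module FaceCounting {G : Graph} (P : PlaneEmbedding G) where
    open Graph G using (_~?_)
    open PlaneEmbedding P
    open Embedding P
    open Degrees G

    side? : ∀ f u v → Dec _
    side? f u v = (u ~? v) ×-dec (face (u , v) ≟ f)

    faceLength≡ : ∀ f → + faceLength f ≡ sum (λ u → sum (λ v → 𝟙 (side? f u v)))
    faceLength≡ f = length-filter-pairs (λ (u , v) → side? f u v)

    sum-faceLength : sum (λ f → + faceLength f) ≡ #darts
    sum-faceLength = begin
      sum (λ f → + faceLength f)
        ≡⟨ sum-cong faceLength≡ ⟩
      sum (λ f → sum (λ u → sum (λ v → 𝟙 (side? f u v))))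
        ≡⟨ sum-comm (λ f u → sum (λ v → 𝟙 (side? f u v))) ⟩
      sum (λ u → sum (λ f → sum (λ v → 𝟙 (side? f u v))))
        ≡⟨ sum-cong (λ u → trans (sum-comm (λ f v → 𝟙 (side? f u v))) (sum-cong (λ v → one-face u v))) ⟩
      #darts ∎
      where
      one-face : ∀ u v → sum (λ f → 𝟙 (side? f u v)) ≡ 𝟙 (u ~? v)
      one-face u v = trans
        (sum-cong (λ f → trans (𝟙-× (u ~? v) (face (u , v) ≟ f)) (ℤ.*-comm (𝟙 (u ~? v)) (δ (face (u , v)) f))))
        (sum-δ (face (u , v)) (λ _ → 𝟙 (u ~? v)))

    -- The indicator of a dart on `f` is a sum over the four sides; as `y` is injective, at most one
    -- side contributes.
    quad-faceLength : ∀ {f y} → FacialQuad f y → faceLength f ≡ 4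
    quad-faceLength {f} {y} Q = ℤ.+-injective (begin
      + faceLength f
        ≡⟨ faceLength≡ f ⟩
      sum (λ u → sum (λ v → 𝟙 (side? f u v)))
        ≡⟨ sum-cong (λ u → sum-cong (λ v → side u v)) ⟩
      sum (λ u → sum (λ v → sum (λ i → δ (y i) u * δ (y (next i)) v)))
        ≡⟨ sum-cong (λ u → sum-comm (λ v i → δ (y i) u * δ (y (next i)) v)) ⟩
      sum (λ u → sum (λ i → sum (λ v → δ (y i) u * δ (y (next i)) v)))
        ≡⟨ sum-comm (λ u i → sum (λ v → δ (y i) u * δ (y (next i)) v)) ⟩
      sum (λ i → sum (λ u → sum (λ v → δ (y i) u * δ (y (next i)) v)))
        ≡⟨ sum-cong (λ i → trans
             (sum-cong (λ u → trans (sum-cong (λ v → ℤ.*-comm (δ (y i) u) (δ (y (next i)) v)))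
               (trans (sum-δ (y (next i)) (λ _ → δ (y i) u)) (sym (ℤ.*-identityʳ (δ (y i) u))))))
             (sum-δ (y i) (λ _ → 1ℤ))) ⟩
      sum {4} (λ i → 1ℤ)
        ≡⟨ sum-const {4} 1ℤ ⟩
      + 4 ∎)
      where
      open FacialQuad Q
      side : ∀ u v → 𝟙 (side? f u v) ≡ sum (λ i → δ (y i) u * δ (y (next i)) v)
      side u v with side? f u v
      ... | yes (u~v , on) with i , refl , refl ← darts u~v on =
        trans (𝟙-true (side? f u v) (u~v , on)) (sym (begin
        sum (λ j → δ (y j) (y i) * δ (y (next j)) (y (next i)))
          ≡⟨ sum-cong (λ j → cong (_* δ (y (next j)) (y (next i)))
               (𝟙-cong (y j ≟ y i) (i ≟ j) (sym ∘ injective) (cong y ∘ sym))) ⟩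
        sum (λ j → δ i j * δ (y (next j)) (y (next i)))
          ≡⟨ sum-δ i (λ j → δ (y (next j)) (y (next i))) ⟩
        δ (y (next i)) (y (next i))
          ≡⟨ 𝟙-true (y (next i) ≟ y (next i)) refl ⟩
        1ℤ ∎))
      ... | no ¬side = trans (𝟙-false (side? f u v) ¬side) (sym (sum-zero λ i →
        trans (sym (𝟙-× (y i ≟ u) (y (next i) ≟ v)))
        (𝟙-false ((y i ≟ u) ×-dec (y (next i) ≟ v)) λ { (refl , refl) → ¬side (adjacent i , on-face i) })))

    faceLength-bounded : ∀ {f} {x : Fin 4 → Vertex G} → BoundedByCycle f x → faceLength f ≡ 4
    faceLength-bounded = [ quad-faceLength , quad-faceLength ]′ ∘ facialQuad-bounded

    -- Euler's formula is combined with 2E = 3F + 1, where the 1 is the excess of the face of length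
    -- 4. Adding 2E to both sides avoids subtraction.
    size-near-triangulation : ∀ {f₀} → faceLength f₀ ≡ 4 → (∀ f → f ≢ f₀ → faceLength f ≡ 3) →
                              size G ℕ.+ 7 ≡ 3 ℕ.* order G
    size-near-triangulation {f₀} ℓ₀ ℓ = ℕ.+-cancelˡ-≡ (E ℕ.+ E) (E ℕ.+ 7) (3 ℕ.* V) (begin
      E ℕ.+ E ℕ.+ (E ℕ.+ 7)              ≡⟨ group₁ E ⟩
      3 ℕ.* (E ℕ.+ 2) ℕ.+ 1              ≡⟨ cong (λ k → 3 ℕ.* k ℕ.+ 1) (sym euler) ⟩
      3 ℕ.* (V ℕ.+ #faces) ℕ.+ 1         ≡⟨ group₂ V #faces ⟩
      #faces ℕ.* 3 ℕ.+ 1 ℕ.+ 3 ℕ.* V     ≡⟨ cong (ℕ._+ 3 ℕ.* V) (sym twice-size) ⟩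
      E ℕ.+ E ℕ.+ 3 ℕ.* V                ∎)
      where
      E = size G
      V = order G

      group₁ : ∀ e → e ℕ.+ e ℕ.+ (e ℕ.+ 7) ≡ 3 ℕ.* (e ℕ.+ 2) ℕ.+ 1
      group₁ e = ℕ-Solver.solve (e ∷ [])
      group₂ : ∀ v f → 3 ℕ.* (v ℕ.+ f) ℕ.+ 1 ≡ f ℕ.* 3 ℕ.+ 1 ℕ.+ 3 ℕ.* v
      group₂ v f = ℕ-Solver.solve (v ∷ f ∷ [])

      length≡ : ∀ f → + faceLength f ≡ + 3 + δ f₀ f * 1ℤ
      length≡ f with f₀ ≟ f
      ... | yes refl = cong +_ ℓ₀
      ... | no f₀≢f  = cong +_ (ℓ f (f₀≢f ∘ sym))

      twice-size : E ℕ.+ E ≡ #faces ℕ.* 3 ℕ.+ 1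
      twice-size = ℤ.+-injective (begin
        + E + + E                              ≡⟨ trans handshake (sym sum-faceLength) ⟩
        sum (λ f → + faceLength f)             ≡⟨ sum-cong length≡ ⟩
        sum (λ f → + 3 + δ f₀ f * 1ℤ)          ≡⟨ sum-+ (λ _ → + 3) (λ f → δ f₀ f * 1ℤ) ⟩
        sum {#faces} (λ _ → + 3) + sum (λ f → δ f₀ f * 1ℤ)
          ≡⟨ cong₂ _+_ (sum-const {#faces} (+ 3)) (sum-δ f₀ (λ _ → 1ℤ)) ⟩
        + #faces * + 3 + 1ℤ                    ≡⟨ cong (_+ 1ℤ) (sym (ℤ.pos-* #faces 3)) ⟩
        + (#faces ℕ.* 3 ℕ.+ 1)                 ∎)

-- Branch sets in the cone

open import Data.Nat.Base using (_+_; _*_)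

∈-image⁺ : ∀ {n k} (x : Fin k → Fin n) i → x i ∈ image x
∈-image⁺ x zero    = x∈p∪q⁺ (inj₁ (x∈⁅x⁆ (x zero)))
∈-image⁺ x (suc i) = x∈p∪q⁺ (inj₂ (∈-image⁺ (x ∘ suc) i))

-- If the apex is deleted, fewer than k deletions remain for `G`; otherwise the apex joins any two
-- surviving vertices.
cone-KConnected : ∀ {G k} → KConnected G k → KConnected (cone G) (suc k)
cone-KConnected {G} {k} (k<n , conn) = s≤s k<n , cone-conn
  where
  cone-conn : ∀ S → ∣ S ∣ ℕ.< suc k → InducesConnected (cone G) (∁ S)
  cone-conn (inside Vec.∷ S) (s≤s |S|<k) (there u∈) (there v∈) =
    Star.gmap suc (λ (a∈ , b∈ , a~b) → there a∈ , there b∈ , a~b) (conn S |S|<k u∈ v∈)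
  cone-conn (outside Vec.∷ S) _ here       here       = ε
  cone-conn (outside Vec.∷ S) _ here       (there v∈) = (here , there v∈ , tt) ◅ ε
  cone-conn (outside Vec.∷ S) _ (there u∈) here       = (there u∈ , here , tt) ◅ ε
  cone-conn (outside Vec.∷ S) _ (there u∈) (there v∈) = (there u∈ , here , tt) ◅ (here , there v∈ , tt) ◅ ε

module _ {k : ℕ} {G : Graph} (μ : Model (complete k) G) where
  open Graph G using (_~_; ~-sym)
  open Model μ

  edge-joins : (e : Edge (complete k)) → let open Edge e in
               ∃₂ λ a b → a ∈ branch end₁ × b ∈ branch end₂ × a ~ b
  edge-joins e with edge-ends e
  ... | inj₁ (a∈ , b∈) = _ , _ , a∈ , b∈ , Edge.adjacent (edge e)
  ... | inj₂ (a∈ , b∈) = _ , _ , b∈ , a∈ , ~-sym (Edge.adjacent (edge e))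

  branches-adjacent : ∀ {u v} → u ≢ v → ∃₂ λ a b → a ∈ branch u × b ∈ branch v × a ~ b
  branches-adjacent {u} {v} u≢v with <-cmp u v
  ... | tri< u<v _ _ = edge-joins (record { ordered = u<v ; adjacent = u≢v })
  ... | tri≈ _ u≡v _ = contradiction u≡v u≢v
  ... | tri> _ _ v<u =
    let a , b , a∈ , b∈ , a~b = edge-joins (record { ordered = v<u ; adjacent = u≢v ∘ sym })
    in b , a , b∈ , a∈ , ~-sym a~b

-- The bijection is arbitrary, so the branch set of each root is found by surjectivity. The equation
-- for `π` is kept because it shows that distinct roots get distinct branch sets.
rooted-branches : ∀ {k G} (x : Fin k → Vertex G) (inj : Injective _≡_ _≡_ x) →
                  ((π , μ , _) : HasRootedCompleteMinor (rootedAt G x inj)) →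
                  ∀ i → ∃[ v ] proj₁ (Bijection.to π v) ≡ x i × x i ∈ Model.branch μ v
rooted-branches x inj (π , μ , rooted) i =
  let v , eq = Bijection.strictlySurjective π (x i , ∈-image⁺ x i)
      eq′ = cong proj₁ eq
  in v , eq′ , subst (_∈ Model.branch μ v) eq′ (rooted v)

module _ {G : Graph} (P : PlaneEmbedding G) where
  open Graph G using (_~_)
  open PlaneEmbedding P
  open Embedding P

  cone-no-rooted-model : ∀ {f} {x : Fin 4 → Vertex G} → BoundedByCycle f x →
    (μ : Model (complete 5) (cone G)) (index : Fin 5 → Fin 5) → Injective _≡_ _≡_ index →
    (∀ i → withApex G x i ∈ Model.branch μ (index i)) → ⊥
  cone-no-rooted-model bounded μ index index-injective root∈ =
    quadrilateral-separates bounded (Pair 0F 2F) (Pair 1F 3F)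
      (λ where
        (inj₁ p) (inj₁ q) → apart (λ ()) p q
        (inj₁ p) (inj₂ q) → apart (λ ()) p q
        (inj₂ p) (inj₁ q) → apart (λ ()) p q
        (inj₂ p) (inj₂ q) → apart (λ ()) p q)
      -- Index 0F of `root∈` is the apex, so 1F and 3F belong to the corners `x 0F` and `x 2F`.
      (pair-connected (λ ())) (inj₁ (root∈ 1F)) (inj₂ (root∈ 3F))
      (pair-connected (λ ())) (inj₁ (root∈ 2F)) (inj₂ (root∈ 4F))
    where
    open Model μ

    apart : ∀ {i j} → i ≢ j → ∀ {w} → w ∈ branch (index i) → w ∉ branch (index j)
    apart i≢j = branch-disjoint (i≢j ∘ index-injective)

    -- The apex lies in the branch set of its own root, so the branch sets of the corners consist of
    -- base vertices only and lose nothing when read in `G`.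
    InBranch : Fin 4 → Vertex G → Set
    InBranch i v = base G v ∈ branch (index (suc i))

    apex∉ : ∀ i → apex G ∉ branch (index (suc i))
    apex∉ i = apart (λ ()) (root∈ 0F)

    Pair : Fin 4 → Fin 4 → Vertex G → Set
    Pair i j v = InBranch i v ⊎ InBranch j v

    branch-walk : ∀ i {u v} → Star (Graph.InducedAdj (cone G) (branch (index (suc i)))) (suc u) (suc v) →
                  Star (Within (InBranch i)) u v
    branch-walk i ε = ε
    branch-walk i (_◅_ {_} {zero}  (_  , 0∈ , _) p) = contradiction 0∈ (apex∉ i)
    branch-walk i (_◅_ {_} {suc _} uv p) = uv ◅ branch-walk i p

    in-branch-connected : ∀ i → IsConnected (InBranch i)
    in-branch-connected i u∈ v∈ = branch-walk i (branch-connected (index (suc i)) u∈ v∈)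

    widen : ∀ {A B : Vertex G → Set} → (∀ {v} → A v → B v) → ∀ {u v} → Star (Within A) u v → Star (Within B) u v
    widen A⊆B = Star.map (λ (a , b , u~v) → A⊆B a , A⊆B b , u~v)

    bridge : ∀ {i j} → i ≢ j → ∃₂ λ a b → InBranch i a × InBranch j b × a ~ b
    bridge {i} {j} i≢j with branches-adjacent μ (i≢j ∘ suc-injective ∘ index-injective)
    ... | zero  , _     , a∈ , _  , _   = contradiction a∈ (apex∉ i)
    ... | suc _ , zero  , _  , b∈ , _   = contradiction b∈ (apex∉ j)
    ... | suc a , suc b , a∈ , b∈ , a~b = a , b , a∈ , b∈ , a~b

    pair-connected : ∀ {i j} → i ≢ j → IsConnected (Pair i j)
    pair-connected {i} {j} i≢j = joined
      where
      crossing : ∀ {i j} → i ≢ j → ∀ {u v} → InBranch i u → InBranch j v → Star (Within (Pair i j)) u v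
      crossing {i} {j} i≢j u∈ v∈ =
        let _ , _ , a∈ , b∈ , a~b = bridge i≢j in
        widen inj₁ (in-branch-connected i u∈ a∈)
          ◅◅ (inj₁ a∈ , inj₂ b∈ , a~b) ◅ widen inj₂ (in-branch-connected j b∈ v∈)
      joined : IsConnected (Pair i j)
      joined (inj₁ u∈) (inj₁ v∈) = widen inj₁ (in-branch-connected i u∈ v∈)
      joined (inj₁ u∈) (inj₂ v∈) = crossing i≢j u∈ v∈
      joined (inj₂ u∈) (inj₁ v∈) = widen [ inj₂ , inj₁ ]′ (crossing (i≢j ∘ sym) u∈ v∈)
      joined (inj₂ u∈) (inj₂ v∈) = widen inj₂ (in-branch-connected j u∈ v∈)

  cone-no-rooted-K₅ : ∀ {f} {x : Fin 4 → Vertex G} (bounded : BoundedByCycle f x) →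
                      ¬ HasRootedCompleteMinor (rootedCone G x (IsCycle.injective (proj₁ bounded)))
  cone-no-rooted-K₅ {x = x} bounded minor@(π , μ , _) =
    cone-no-rooted-model bounded μ (proj₁ ∘ at)
      (λ {i} {j} eq → inj (trans (sym (proj₁ (proj₂ (at i))))
        (trans (cong (λ v → proj₁ (Bijection.to π v)) eq) (proj₁ (proj₂ (at j))))))
      (λ i → proj₂ (proj₂ (at i)))
    where
    inj = withApex-injective G x (IsCycle.injective (proj₁ bounded))
    at = rooted-branches (withApex G x) inj minor

mainTheorem2 :
    (n : ℕ) (G₀ : Graph) →
    suc (order G₀) ≡ n →
    KConnected G₀ 5 →
    (P : PlaneEmbedding G₀) →
    let open PlaneEmbedding P in
    (f₀ : Face) (x : Fin 4 → Vertex G₀)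
    (f₀-bounded : BoundedByCycle f₀ x) →
    (∀ f → f ≢ f₀ → faceLength f ≡ 3) →
    let G = cone G₀
        R = rootedCone G₀ x (IsCycle.injective (proj₁ f₀-bounded))
    in
    KConnected G 6 ×
    order G ≡ n ×
    size G + 11 ≡ 4 * n ×
    ¬ HasRootedCompleteMinor R
mainTheorem2 n G₀ refl 5-connected P f₀ x f₀-bounded triangles =
  cone-KConnected {G₀} 5-connected , refl , edge-count , cone-no-rooted-K₅ P f₀-bounded
  where
  open PlaneEmbedding P
  open FaceCounting P

  edge-count : size (cone G₀) + 11 ≡ 4 * suc (order G₀)
  edge-count = trans (cong (_+ 11) (size-cone G₀))
    (arithmetic (size G₀) (order G₀) (size-near-triangulation (faceLength-bounded f₀-bounded) triangles))
    where
    split : ∀ e v → e + v + 11 ≡ v + 4 + (e + 7)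
    split e v = ℕ-Solver.solve (e ∷ v ∷ [])
    collect : ∀ v → v + 4 + 3 * v ≡ 4 * suc v
    collect v = ℕ-Solver.solve (v ∷ [])
    arithmetic : ∀ e v → e + 7 ≡ 3 * v → e + v + 11 ≡ 4 * suc v
    arithmetic e v eq = trans (split e v) (trans (cong (v + 4 +_) eq) (collect v))
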